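{- The satisfiability problem for Strategy Logic (SL) is highly undecidable; in particular, it is $\Sigma^1_1$-hard. That is, deciding, for a given SL sentence $\varphi$, whether there exists a concurrent game structure $G$ with $G\models\varphi$ is $\Sigma^1_1$-hard.
   Context: A concurrent game structure (CGS) is a tuple $G=(\mathrm{AP},\mathrm{Ag},\mathrm{Ac},\mathrm{St},\lambda,\tau,s_0)$ where $\mathrm{AP}$ and $\mathrm{Ag}$ are finite non-empty sets of atomic propositions and agents, $\mathrm{Ac}$ and $\mathrm{St}$ are countable non-empty sets of actions and states, $s_0\in\mathrm{St}$ is the initial state, $\lambda:\mathrm{St}\to 2^{\mathrm{AP}}$ is a labeling, and $\tau:\mathrm{St}\times\mathrm{Dc}\to\mathrm{St}$ is the transition function, where $\mathrm{Dc}=\mathrm{Ac}^{\mathrm{Ag}}$ is the set of decisions. A track (resp. path) is a non-empty finite (resp. infinite) sequence of states $\rho$ such that for every $i$, $\rho_{i+1}=\tau(\rho_i,\delta)$ for some decision $\delta$. A strategy is a function from tracks to $\mathrm{Ac}$. Given a set $\mathrm{Var}$ of variables, an assignment is a partial function $\chi$ from $\mathrm{Var}\cup\mathrm{Ag}$ to strategies; it is complete if it is defined on all agents; $\chi[l\mapsto f]$ agrees with $\chi$ except that it maps $l$ to $f$. For a complete $\chi$ and a state $s$, $\mathrm{play}(\chi,s)$ is the path $\pi$ with $\pi_0=s$ and $\pi_{i+1}=\tau(\pi_i,\delta_i)$ where $\delta_i(a)=\chi(a)(\pi_0\cdots\pi_i)$. The $i$-th translation $(\chi,s)^i$ is the pair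 $(\chi',\pi_i)$ where $\chi'(l)(\rho)=\chi(l)(\pi_0\cdots\pi_{i-1}\cdot\rho)$ for all $l$ in the domain of $\chi$ and tracks $\rho$ starting at $\pi_i$. SL formulas: $\varphi::=p\mid\neg\varphi\mid\varphi\wedge\varphi\mid\varphi\vee\varphi\mid \mathsf{X}\varphi\mid\varphi\,\mathsf{U}\,\varphi\mid\varphi\,\mathsf{R}\,\varphi\mid\langle\langle x\rangle\rangle\varphi\mid[\![x]\!]\varphi\mid(a,x)\varphi$ with $p\in\mathrm{AP}$, $x\in\mathrm{Var}$, $a\in\mathrm{Ag}$. Free agents/variables: $\mathrm{free}(p)=\emptyset$; $\mathrm{free}(\neg\varphi)=\mathrm{free}(\varphi)$; $\mathrm{free}(\varphi_1\wedge\varphi_2)=\mathrm{free}(\varphi_1\vee\varphi_2)=\mathrm{free}(\varphi_1)\cup\mathrm{free}(\varphi_2)$; $\mathrm{free}(\mathsf{X}\varphi)=\mathrm{Ag}\cup\mathrm{free}(\varphi)$; $\mathrm{free}(\varphi_1\mathsf{U}\varphi_2)=\mathrm{free}(\varphi_1\mathsf{R}\varphi_2)=\mathrm{Ag}\cup\mathrm{free}(\varphi_1)\cup\mathrm{free}(\varphi_2)$; $\mathrm{free}(\langle\langle x\rangle\rangle\varphi)=\mathrm{free}([\![x]\!]\varphi)=\mathrm{free}(\varphi)\setminus\{x\}$; $\mathrm{free}((a,x)\varphi)=\mathrm{free}(\varphi)$ if $a\notin\mathrm{free}(\varphi)$ and $(\mathrm{free}(\varphi)\setminus\{a\})\cup\{x\}$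 otherwise. A sentence has no free agents or variables. Semantics, for $\mathrm{free}(\varphi)\subseteq\mathrm{dom}(\chi)$: $G,\chi,s\models p$ iff $p\in\lambda(s)$; Boolean connectives as usual; $G,\chi,s\models\langle\langle x\rangle\rangle\varphi$ iff for some strategy $f$, $G,\chi[x\mapsto f],s\models\varphi$; $[\![x]\!]$ dually with "for all"; $G,\chi,s\models(a,x)\varphi$ iff $G,\chi[a\mapsto\chi(x)],s\models\varphi$; for complete $\chi$: $\mathsf{X}\varphi$ holds iff $G,(\chi,s)^1\models\varphi$; $\varphi_1\mathsf{U}\varphi_2$ iff there is $i$ with $G,(\chi,s)^i\models\varphi_2$ and $G,(\chi,s)^j\models\varphi_1$ for all $j<i$; $\varphi_1\mathsf{R}\varphi_2$ iff for all $i$, $G,(\chi,s)^i\models\varphi_2$ or $G,(\chi,s)^j\models\varphi_1$ for some $j<i$. $G\models\varphi$ iff $G,\emptyset,s_0\models\varphi$ ($\emptyset$ the empty assignment); $\varphi$ is satisfiable iff it has a model. -}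

module Defs where

open import Data.Nat using (ℕ; zero; suc; _+_; _*_; _<_)
open import Data.Fin using (Fin)
open import Data.Fin.Properties using () renaming (_≟_ to _≟ᶠ_)
open import Data.Nat.Properties using () renaming (_≟_ to _≟ⁿ_)
open import Data.Bool using (Bool; true)
open import Data.Maybe using (Maybe; just; nothing)
import Data.Maybe as Maybe
open import Data.List using (List; [])
open import Data.List.NonEmpty using (List⁺; _∷_; _++⁺_; _∷ʳ_; last; toList)
open import Data.Sum using (_⊎_; inj₁; inj₂)
open import Data.Sum.Properties using (≡-dec)
open import Data.Product using (Σ; _×_; _,_; proj₁; ∃)
open import Data.Empty using (⊥)
open import Relation.Nullary using (¬_; yes; no)
open import Relation.Binary.PropositionalEquality using (_≡_; _≢_)
open import Function.Bundles using (_↣_; _⇔_)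
open import Axiom.ExcludedMiddle using (ExcludedMiddle)
open import Level using (0ℓ) renaming (suc to lsuc)

1ℓ = lsuc 0ℓ

-- Concurrent game structures with AP = Fin n and Ag = Fin m
-- (n, m ≥ 1 is imposed where CGSs are used, see Satisfiable).
-- Countable = injectable into ℕ.

record CGS (n m : ℕ) : Set₁ where
  field
    St          : Set
    Ac          : Set
    St-countable : St ↣ ℕ
    Ac-countable : Ac ↣ ℕ
    s₀          : St
    someAction  : Ac
    label       : St → Fin n → Bool
    τ           : St → (Fin m → Ac) → St

Var : Set
Var = ℕ

data Formula (n m : ℕ) : Set where
  atom : Fin n → Formula n m
  ¬ᶠ_  : Formula n m → Formula n m
  _∧ᶠ_ _∨ᶠ_ : Formula n m → Formula n m → Formula n m
  X    : Formula n m → Formula n m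
  _U_ _R_ : Formula n m → Formula n m → Formula n m
  ⟨⟨_⟩⟩_ : Var → Formula n m → Formula n m
  [[_]]_ : Var → Formula n m → Formula n m
  bind : Fin m → Var → Formula n m → Formula n m

Label : ℕ → Set
Label m = Var ⊎ Fin m

IsAgent : ∀ {m} → Label m → Set
IsAgent (inj₁ _) = ⊥
IsAgent (inj₂ _) = Data.Unit.⊤ where import Data.Unit

Free : ∀ {n m} → Formula n m → Label m → Set
Free (atom p) l = ⊥
Free (¬ᶠ φ) l = Free φ l
Free (φ ∧ᶠ ψ) l = Free φ l ⊎ Free ψ l
Free (φ ∨ᶠ ψ) l = Free φ l ⊎ Free ψ l
Free (X φ) l = IsAgent l ⊎ Free φ l
Free (φ U ψ) l = IsAgent l ⊎ (Free φ l ⊎ Free ψ l)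
Free (φ R ψ) l = IsAgent l ⊎ (Free φ l ⊎ Free ψ l)
Free (⟨⟨ x ⟩⟩ φ) l = Free φ l × l ≢ inj₁ x
Free ([[ x ]] φ) l = Free φ l × l ≢ inj₁ x
Free (bind a x φ) l =
  (¬ Free φ (inj₂ a) × Free φ l) ⊎
  (Free φ (inj₂ a) × ((Free φ l × l ≢ inj₂ a) ⊎ l ≡ inj₁ x))

IsSentence : ∀ {n m} → Formula n m → Set
IsSentence {m = m} φ = (l : Label m) → ¬ Free φ l

module Semantics {n m : ℕ} (G : CGS n m) where
  open CGS G

  Strategy : Set
  Strategy = List⁺ St → Ac

  Assignment : Set
  Assignment = Label m → Maybe Strategy

  _[_↦_] : Assignment → Label m → Maybe Strategy → Assignment
  (χ [ l ↦ f ]) l' with ≡-dec _≟ⁿ_ _≟ᶠ_ l' l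
  ... | yes _ = f
  ... | no  _ = χ l'

  Complete : Assignment → Set
  Complete χ = (a : Fin m) → Σ Strategy λ f → χ (inj₂ a) ≡ just f

  module _ (χ : Assignment) (c : Complete χ) (s : St) where
    prefix : ℕ → List⁺ St
    prefix zero = s ∷ []
    prefix (suc i) =
      toList (prefix i) ∷ʳ τ (last (prefix i)) (λ a → proj₁ (c a) (prefix i))

    π : ℕ → St
    π i = last (prefix i)

    before : ℕ → List St
    before zero = []
    before (suc i) = toList (prefix i)

    transA : ℕ → Assignment
    transA i l = Maybe.map (λ f ρ → f (before i ++⁺ ρ)) (χ l)

  sat : Formula n m → Assignment → St → Set
  sat (atom p) χ s = label s p ≡ true
  sat (¬ᶠ φ) χ s = ¬ sat φ χ s
  sat (φ ∧ᶠ ψ) χ s = sat φ χ s × sat ψ χ s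
  sat (φ ∨ᶠ ψ) χ s = sat φ χ s ⊎ sat ψ χ s
  sat (X φ) χ s = Σ (Complete χ) λ c → sat φ (transA χ c s 1) (π χ c s 1)
  sat (φ U ψ) χ s = Σ (Complete χ) λ c →
    ∃ λ i → sat ψ (transA χ c s i) (π χ c s i)
          × ((j : ℕ) → j < i → sat φ (transA χ c s j) (π χ c s j))
  sat (φ R ψ) χ s = Σ (Complete χ) λ c → (i : ℕ) →
    sat ψ (transA χ c s i) (π χ c s i)
    ⊎ (∃ λ j → j < i × sat φ (transA χ c s j) (π χ c s j))
  sat (⟨⟨ x ⟩⟩ φ) χ s = Σ Strategy λ f → sat φ (χ [ inj₁ x ↦ just f ]) s
  sat ([[ x ]] φ) χ s = (f : Strategy) → sat φ (χ [ inj₁ x ↦ just f ]) s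
  sat (bind a x φ) χ s = sat φ (χ [ inj₂ a ↦ χ (inj₁ x) ]) s

  emptyAssignment : Assignment
  emptyAssignment _ = nothing

_⊨_ : ∀ {n m} → CGS n m → Formula n m → Set
G ⊨ φ = Semantics.sat G φ (Semantics.emptyAssignment G) (CGS.s₀ G)

record SLSentence : Set where
  field
    nAP nAg  : ℕ
    formula  : Formula (suc nAP) (suc nAg)
    sentence : IsSentence formula

Satisfiable : SLSentence → Set₁
Satisfiable σ = Σ (CGS (suc nAP) (suc nAg)) λ G → G ⊨ formula
  where open SLSentence σ

-- number variables are de Bruijn indices; function variables are Fin k
data ATerm (k : ℕ) : Set where
  var  : ℕ → ATerm k
  zeroᵗ : ATerm k
  sucᵗ : ATerm k → ATerm k
  _+ᵗ_ _*ᵗ_ : ATerm k → ATerm k → ATerm k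
  app  : Fin k → ATerm k → ATerm k

data AForm (k : ℕ) : Set where
  _=ᵃ_ _<ᵃ_ : ATerm k → ATerm k → AForm k
  ¬ᵃ_ : AForm k → AForm k
  _∧ᵃ_ _∨ᵃ_ : AForm k → AForm k → AForm k
  ∀ᵃ ∃ᵃ : AForm k → AForm k

Env : Set
Env = ℕ → ℕ

_∷ₑ_ : ℕ → Env → Env
(v ∷ₑ e) zero = v
(v ∷ₑ e) (suc i) = e i

evalT : ∀ {k} → ATerm k → Env → (Fin k → ℕ → ℕ) → ℕ
evalT (var i) e fs = e i
evalT zeroᵗ e fs = zero
evalT (sucᵗ t) e fs = suc (evalT t e fs)
evalT (t +ᵗ u) e fs = evalT t e fs + evalT u e fs
evalT (t *ᵗ u) e fs = evalT t e fs * evalT u e fs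
evalT (app j t) e fs = fs j (evalT t e fs)

evalF : ∀ {k} → AForm k → Env → (Fin k → ℕ → ℕ) → Set
evalF (t =ᵃ u) e fs = evalT t e fs ≡ evalT u e fs
evalF (t <ᵃ u) e fs = evalT t e fs < evalT u e fs
evalF (¬ᵃ θ) e fs = ¬ evalF θ e fs
evalF (θ ∧ᵃ η) e fs = evalF θ e fs × evalF η e fs
evalF (θ ∨ᵃ η) e fs = evalF θ e fs ⊎ evalF η e fs
evalF (∀ᵃ θ) e fs = (v : ℕ) → evalF θ (v ∷ₑ e) fs
evalF (∃ᵃ θ) e fs = Σ ℕ λ v → evalF θ (v ∷ₑ e) fs

-- The Σ¹₁ set defined by θ (the input n is number variable 0):
-- { n | ∃ f₁ … f_k : ℕ → ℕ . θ(n, f⃗) }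
Σ¹₁Set : ∀ {k} → AForm k → ℕ → Set
Σ¹₁Set {k} θ n = Σ (Fin k → ℕ → ℕ) λ fs → evalF θ (n ∷ₑ (λ _ → zero)) fs

-- Classical logic, used as an explicit hypothesis for the correctness
-- part only (the paper reasons classically).
Classical : Set₂
Classical = ExcludedMiddle 0ℓ × ExcludedMiddle 1ℓ

-- Σ¹₁-hardness of a problem P on SL sentences: every Σ¹₁ set many-one
-- reduces to P. The reduction g is chosen from the code θ alone, BEFORE
-- the classical hypothesis is available, so it is a genuinely computable
-- (Agda-definable, --safe, postulate-free) function of θ.
Σ¹₁-hard : (SLSentence → Set₁) → Set₂
Σ¹₁-hard P = (k : ℕ) (θ : AForm k) →
  Σ (ℕ → SLSentence) λ g → Classical → (n : ℕ) → Σ¹₁Set θ n ⇔ P (g n)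

{-# OPTIONS --safe #-}
module Submission where

open import Defs
open import Data.Bool using (Bool; true; false)
open import Data.Bool.Properties using () renaming (_≟_ to _≟ᵇ_)
open import Data.Empty using (⊥-elim)
open import Data.Fin using (Fin; zero; suc; _↑ʳ_)
open import Data.Fin.Patterns using (0F; 1F; 2F; 3F; 4F; 5F)
open import Data.List using ([]; _∷_)
open import Data.List.NonEmpty using (List⁺; _∷_; _++⁺_; last)
open import Data.Maybe using (just)
import Data.Maybe as Maybe
open import Data.Maybe.Properties using (just-injective)
open import Data.Nat using (ℕ; zero; suc; _+_; _*_; _<_; _≤_; ∣_-_∣; _≟_)
open import Data.Nat.Properties
  using (≤-refl; ≤-trans; n≤1+n; <⇒≢; suc-injective; +-suc; +-comm; +-identityʳ; *-zeroʳ; *-suc;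
         1+n≢0; *-cancelˡ-≡; even≢odd; ∣n-n∣≡0; ∣m-n∣≡0⇒m≡n; m≤n⇒∃[o]m+o≡n; m≤m+n)
open import Data.Product using (Σ; ∃; _×_; _,_; proj₁; proj₂)
open import Data.Sum using (_⊎_; inj₁; inj₂; [_,_]′)
open import Data.Sum.Properties using (inj₁-injective; ≡-dec)
import Data.Fin.Properties as Finₚ
open import Data.Vec.Functional using (Vector) renaming ([] to ε; _∷_ to _◂_)
open import Axiom.ExcludedMiddle using (ExcludedMiddle)
open import Function using (_∘_; id; case_of_)
open import Function.Bundles using (_⇔_; mk⇔; Equivalence; mk↣)
open import Level using (0ℓ)
open import Relation.Nullary using (¬_; Dec; yes; no; does; contradiction)
open import Relation.Nullary.Decidable using (dec-true; decidable-stable)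
open import Relation.Binary.PropositionalEquality
  using (_≡_; _≢_; _≗_; refl; sym; trans; cong; cong₂; subst; subst₂)

open Equivalence using (to; from)

-- At a fixed initial state, a strategy is an action followed by an answer at
-- each possible next state.  Hence the one-step formulas of SL contain
-- first-order logic over the actions (with ternary relations, for three
-- agents), and the two-step formulas let a strategy Y quantify over sets: the
-- action x belongs to Y when the answer of Y, after everybody has played x,
-- leads to a state satisfying a fixed proposition.  This suffices for the
-- second-order Peano axioms, so that the models of the resulting sentence are
-- copies of ℕ in which the remaining relations are arbitrary functions; they
-- witness the second-order existential quantifiers of a Σ¹₁ definition.

-- A language of relations and sets, and its translation into SL

-- mem true Y x is membership; mem false Y x is its failure expressed below the
-- temporal operators, which needs the axiom in sets to be its negation.
data MForm (k d : ℕ) : Set where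
  rel : Fin k → (x y z : Fin d) → MForm k d
  mem : Bool → (Y x : Fin d) → MForm k d
  ¬ₘ_ : MForm k d → MForm k d
  _∧ₘ_ _∨ₘ_ _⇒ₘ_ : MForm k d → MForm k d → MForm k d
  ∀ₘ_ ∃ₘ_ : MForm k (suc d) → MForm k d

infixr 5 _∧ₘ_ _∨ₘ_
infixr 4 _⇒ₘ_
infix 6 ¬ₘ_
infixr 3 ∀ₘ_ ∃ₘ_

record Structure (k : ℕ) : Set₁ where
  field
    D   : Set
    Rel : Fin k → D → D → D → Set
    Mem : Bool → D → D → Set

module _ {k : ℕ} (S : Structure k) where
  open Structure S

  evalM : ∀ {d} → MForm k d → Vector D d → Set
  evalM (rel i x y z) V = Rel i (V x) (V y) (V z)
  evalM (mem b Y x) V = Mem b (V Y) (V x)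
  evalM (¬ₘ φ) V = ¬ evalM φ V
  evalM (φ ∧ₘ ψ) V = evalM φ V × evalM ψ V
  evalM (φ ∨ₘ ψ) V = evalM φ V ⊎ evalM ψ V
  evalM (φ ⇒ₘ ψ) V = evalM φ V → evalM ψ V
  evalM (∀ₘ φ) V = ∀ f → evalM φ (f ◂ V)
  evalM (∃ₘ φ) V = Σ D λ f → evalM φ (f ◂ V)

-- A de Bruijn index is named by its level, so that the quantifier binding it
-- at depth d binds the variable d.
name : ∀ {d} → Fin d → Var
name {suc d} zero = d
name {suc d} (suc i) = name i

name< : ∀ {d} (i : Fin d) → name i < d
name< zero = ≤-refl
name< (suc i) = ≤-trans (name< i) (n≤1+n _)

bindAll : ∀ {n} → Vector Var 3 → Formula n 3 → Formula n 3
bindAll xs φ = bind 0F (xs 0F) (bind 1F (xs 1F) (bind 2F (xs 2F) φ))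

literal : ∀ {n m} → Bool → Fin n → Formula n m
literal true p = atom p
literal false p = ¬ᶠ atom p

thrice : ∀ {A : Set} → A → Vector A 3
thrice x = x ◂ x ◂ x ◂ ε

-- Proposition `zero` is reserved for membership, so relation `i` is read off proposition `suc i`.
-- In `mem` all agents play alike, so that each of the two steps is governed by a single strategy.
toSL : ∀ {k d} → MForm k d → Formula (suc k) 3
toSL (rel i x y z) = bindAll (name x ◂ name y ◂ name z ◂ ε) (X (atom (suc i)))
toSL (mem b Y x) =
  bindAll (thrice (name x)) (X (bindAll (thrice (name Y)) (X (literal b zero))))
toSL (¬ₘ φ) = ¬ᶠ toSL φ
toSL (φ ∧ₘ ψ) = toSL φ ∧ᶠ toSL ψ
toSL (φ ∨ₘ ψ) = toSL φ ∨ᶠ toSL ψ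
toSL (φ ⇒ₘ ψ) = (¬ᶠ toSL φ) ∨ᶠ toSL ψ
toSL {d = d} (∀ₘ φ) = [[ d ]] toSL φ
toSL {d = d} (∃ₘ φ) = ⟨⟨ d ⟩⟩ toSL φ

-- Free variables of the translated formulas

free-bind : ∀ {n m a x} (φ : Formula n m) {l} →
  Free (bind a x φ) l → l ≡ inj₁ x ⊎ (Free φ l × l ≢ inj₂ a)
free-bind φ (inj₁ (a∉φ , l∈φ)) = inj₂ (l∈φ , λ { refl → a∉φ l∈φ })
free-bind φ (inj₂ (_ , inj₁ l∈φ)) = inj₂ l∈φ
free-bind φ (inj₂ (_ , inj₂ l≡x)) = inj₁ l≡x

free-bindAll : ∀ {n} xs (φ : Formula n 3) {l} → Free (bindAll xs φ) l →
  (∃ λ a → l ≡ inj₁ (xs a)) ⊎ (Free φ l × (∀ a → l ≢ inj₂ a))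
free-bindAll xs φ l∈ with free-bind (bind _ _ (bind _ _ φ)) l∈
... | inj₁ eq = inj₁ (0F , eq)
... | inj₂ (l∈ , ≢0) with free-bind (bind _ _ φ) l∈
... | inj₁ eq = inj₁ (1F , eq)
... | inj₂ (l∈ , ≢1) with free-bind φ l∈
... | inj₁ eq = inj₁ (2F , eq)
... | inj₂ (l∈ , ≢2) = inj₂ (l∈ , λ { 0F → ≢0 ; 1F → ≢1 ; 2F → ≢2 })

free-literal : ∀ {n m} b {p : Fin n} {l} → ¬ Free {n} {m} (literal b p) l
free-literal true ()
free-literal false ()

-- `X` makes every agent free, and the three bindings capture all of them, as there are exactly
-- three agents.
free-bindAll-X : ∀ {n} xs (φ : Formula n 3) {l} → Free (bindAll xs (X φ)) l →
  (∃ λ a → l ≡ inj₁ (xs a)) ⊎ Free φ l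
free-bindAll-X xs φ l∈ with free-bindAll xs (X φ) l∈
... | inj₁ l∈xs = inj₁ l∈xs
... | inj₂ (inj₂ l∈φ , _) = inj₂ l∈φ
free-bindAll-X xs φ {inj₂ a} l∈ | inj₂ (inj₁ _ , ≢a) = contradiction refl (≢a a)

-- For `d` zero there is no index to name, so closed formulas become sentences.
free-toSL : ∀ {k d} (φ : MForm k d) {l} → Free (toSL φ) l → ∃ λ (i : Fin d) → l ≡ inj₁ (name i)
free-toSL (rel i x y z) l∈ with free-bindAll-X (name x ◂ name y ◂ name z ◂ ε) (atom (suc i)) l∈
... | inj₁ (0F , eq) = x , eq
... | inj₁ (1F , eq) = y , eq
... | inj₁ (2F , eq) = z , eq
free-toSL (mem b Y x) l∈
  with free-bindAll-X (thrice (name x)) (bindAll (thrice (name Y)) (X (literal b zero))) l∈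
... | inj₁ (0F , eq) = x , eq
... | inj₁ (1F , eq) = x , eq
... | inj₁ (2F , eq) = x , eq
... | inj₂ l∈ with free-bindAll-X (thrice (name Y)) (literal b zero) l∈
... | inj₁ (0F , eq) = Y , eq
... | inj₁ (1F , eq) = Y , eq
... | inj₁ (2F , eq) = Y , eq
... | inj₂ l∈ = ⊥-elim (free-literal b l∈)
free-toSL (¬ₘ φ) l∈ = free-toSL φ l∈
free-toSL (φ ∧ₘ ψ) = [ free-toSL φ , free-toSL ψ ]′
free-toSL (φ ∨ₘ ψ) = [ free-toSL φ , free-toSL ψ ]′
free-toSL (φ ⇒ₘ ψ) = [ free-toSL φ , free-toSL ψ ]′
free-toSL (∀ₘ φ) (l∈ , l≢d) with free-toSL φ l∈
... | zero , eq = contradiction eq l≢d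
... | suc i , eq = i , eq
free-toSL (∃ₘ φ) (l∈ , l≢d) with free-toSL φ l∈
... | zero , eq = contradiction eq l≢d
... | suc i , eq = i , eq

-- Correctness of the translation: the strategies of a CGS as a structure

Literal : Bool → Bool → Set
Literal true v = v ≡ true
Literal false v = ¬ v ≡ true

module StrategyStructure {k : ℕ} (G : CGS (suc k) 3) where
  open CGS G
  open Semantics G

  after : St → Vector Strategy 3 → St
  after s e = τ s (λ a → e a (s ∷ []))

  -- The one-step translation of a single strategy. With `after`, it agrees definitionally with
  -- `transA` and `π` at 1, so `sat-step` passes satisfaction proofs through unchanged.
  _shifted_ : Strategy → St → Strategy
  (f shifted s) ρ = f ((s ∷ []) ++⁺ ρ)

  -- Completeness witnesses determine a decision only up to ≗, so without
  -- function extensionality the successor state is not unique: hence the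
  -- quantification over e and e′.
  strategies : Structure k
  strategies = record
    { D = Strategy
    ; Rel = λ i f g h → Σ (Vector Strategy 3) λ e →
        e ≗ (f ◂ g ◂ h ◂ ε) × label (after s₀ e) (suc i) ≡ true
    ; Mem = λ b Y f → Σ (Vector Strategy 3) λ e → e ≗ thrice f ×
        Σ (Vector Strategy 3) λ e′ → e′ ≗ thrice (Y shifted s₀) ×
        Literal b (label (after (after s₀ e) e′) zero)
    }

  bound : Assignment → Vector Var 3 → Assignment
  bound χ xs = χ₂ [ inj₂ 2F ↦ χ₂ (inj₁ (xs 2F)) ]
    where
    χ₁ = χ [ inj₂ 0F ↦ χ (inj₁ (xs 0F)) ]
    χ₂ = χ₁ [ inj₂ 1F ↦ χ₁ (inj₁ (xs 1F)) ]

  shift : Assignment → St → Assignment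
  shift χ s l = Maybe.map (_shifted s) (χ l)

  bound-agent : ∀ χ xs a → bound χ xs (inj₂ a) ≡ χ (inj₁ (xs a))
  bound-agent χ xs 0F = refl
  bound-agent χ xs 1F = refl
  bound-agent χ xs 2F = refl

  -- The completeness witness in the semantics of `X` provides `e`; it agrees with `w` because both
  -- are values of the same entries of the assignment. Conversely any such `e` is a completeness
  -- witness.
  sat-step : ∀ χ s xs {w} ψ → (∀ a → χ (inj₁ (xs a)) ≡ just (w a)) →
    sat (bindAll xs (X ψ)) χ s ⇔
    Σ (Vector Strategy 3) λ e → e ≗ w × sat ψ (shift (bound χ xs) s) (after s e)
  sat-step χ s xs ψ agree = mk⇔
    (λ (c , sat-ψ) → proj₁ ∘ c ,
      (λ a → just-injective (trans (sym (proj₂ (c a))) (trans (bound-agent χ xs a) (agree a)))) ,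
      sat-ψ)
    (λ (e , e≗w , sat-ψ) →
      (λ a → e a , trans (bound-agent χ xs a) (trans (agree a) (cong just (sym (e≗w a))))) ,
      sat-ψ)

  Agree : ∀ {d} → Assignment → Vector Strategy d → Set
  Agree χ V = ∀ i → χ (inj₁ (name i)) ≡ just (V i)

  update-same : ∀ χ l f → (χ [ l ↦ f ]) l ≡ f
  update-same χ l f with ≡-dec _≟_ Finₚ._≟_ l l
  ... | yes _ = refl
  ... | no l≢l = contradiction refl l≢l

  update-other : ∀ χ {l l′} f → l′ ≢ l → (χ [ l ↦ f ]) l′ ≡ χ l′
  update-other χ {l} {l′} f l′≢l with ≡-dec _≟_ Finₚ._≟_ l′ l
  ... | yes l′≡l = contradiction l′≡l l′≢l
  ... | no _ = refl

  agree-update : ∀ {d χ} {V : Vector Strategy d} {f} → Agree χ V →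
    Agree (χ [ inj₁ d ↦ just f ]) (f ◂ V)
  agree-update {d} {χ} agree zero = update-same χ (inj₁ d) _
  agree-update {χ = χ} agree (suc i) =
    trans (update-other χ _ (λ eq → <⇒≢ (name< i) (inj₁-injective eq))) (agree i)

  sat-literal : ∀ b p χ s → sat (literal b p) χ s ⇔ Literal b (label s p)
  sat-literal true p χ s = mk⇔ id id
  sat-literal false p χ s = mk⇔ id id

  agree-thrice : ∀ (χ : Assignment) {x f} → χ (inj₁ x) ≡ just f →
    ∀ a → χ (inj₁ (thrice x a)) ≡ just (thrice f a)
  agree-thrice χ eq 0F = eq
  agree-thrice χ eq 1F = eq
  agree-thrice χ eq 2F = eq

  module _ (em : ExcludedMiddle 0ℓ) where

    sat-toSL : ∀ {d} (φ : MForm k d) {χ V} → Agree χ V →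
      sat (toSL φ) χ s₀ ⇔ evalM strategies φ V
    sat-toSL (rel i x y z) {χ} agree =
      sat-step χ s₀ (name x ◂ name y ◂ name z ◂ ε) (atom (suc i))
        λ { 0F → agree x ; 1F → agree y ; 2F → agree z }
    sat-toSL (mem b Y x) {χ} {V} agree = mk⇔
      (λ p → let (e , e≗ , q) = to outer p
                 (e′ , e′≗ , r) = to inner q
             in e , e≗ , e′ , e′≗ , to (sat-literal b _ _ _) r)
      (λ (e , e≗ , e′ , e′≗ , r) →
        from outer (e , e≗ , from inner (e′ , e′≗ , from (sat-literal b _ _ _) r)))
      where
      χ′ = shift (bound χ (thrice (name x))) s₀
      outer = sat-step χ s₀ (thrice (name x))
        (bindAll (thrice (name Y)) (X (literal b zero))) (agree-thrice χ (agree x))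
      -- At the second step the history already contains `s₀`, so `Y` is played as its shift.
      inner : ∀ {s} → _
      inner {s} = sat-step χ′ s (thrice (name Y)) (literal b zero)
        (agree-thrice χ′ (cong (Maybe.map (_shifted s₀)) (agree Y)))
    sat-toSL (¬ₘ φ) agree = mk⇔ (_∘ from (sat-toSL φ agree)) (_∘ to (sat-toSL φ agree))
    sat-toSL (φ ∧ₘ ψ) agree = mk⇔
      (λ (p , q) → to (sat-toSL φ agree) p , to (sat-toSL ψ agree) q)
      (λ (p , q) → from (sat-toSL φ agree) p , from (sat-toSL ψ agree) q)
    sat-toSL (φ ∨ₘ ψ) agree = mk⇔
      [ inj₁ ∘ to (sat-toSL φ agree) , inj₂ ∘ to (sat-toSL ψ agree) ]′
      [ inj₁ ∘ from (sat-toSL φ agree) , inj₂ ∘ from (sat-toSL ψ agree) ]′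
    sat-toSL (φ ⇒ₘ ψ) {χ} agree = mk⇔
      [ (λ ¬p p → contradiction (from (sat-toSL φ agree) p) ¬p) , (λ q _ → to (sat-toSL ψ agree) q) ]′
      classical
      where
      classical : (_ → _) → _
      -- Deciding the premise turns the implication into the disjunction that translates it.
      classical imp with em {P = sat (toSL φ) χ s₀}
      ... | yes p = inj₂ (from (sat-toSL ψ agree) (imp (to (sat-toSL φ agree) p)))
      ... | no ¬p = inj₁ ¬p
    sat-toSL (∀ₘ φ) {χ} agree = mk⇔
      (λ p f → to (sat-toSL φ (agree-update {χ = χ} agree)) (p f))
      (λ p f → from (sat-toSL φ (agree-update {χ = χ} agree)) (p f))
    sat-toSL (∃ₘ φ) {χ} agree = mk⇔
      (λ (f , p) → f , to (sat-toSL φ (agree-update {χ = χ} agree)) p)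
      (λ (f , p) → f , from (sat-toSL φ (agree-update {χ = χ} agree)) p)

-- Terms and equations expressed through relations

data Tm (k d : ℕ) : Set where
  var : Fin d → Tm k d
  op  : Fin k → Tm k d → Tm k d → Tm k d

⟦_⟧ : ∀ {k d} {A : Set} → Tm k d → (Fin k → A → A → A) → Vector A d → A
⟦ var x ⟧ F V = V x
⟦ op i t u ⟧ F V = F i (⟦ t ⟧ F V) (⟦ u ⟧ F V)

infix 7 _≈_ _≐_
infixl 8 _⊕_ _⊛_

-- Leibniz equality, since the language has no equality symbol.
_≈_ : ∀ {k d} → Fin d → Fin d → MForm k d
x ≈ y = ∀ₘ mem true 0F (suc x) ⇒ₘ mem true 0F (suc y)

-- The usual elimination of function symbols: values of subterms become quantified variables linked
-- by relations. The renaming `σ` spares a weakening of terms under these quantifiers.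
graph : ∀ {k c d} → Tm k c → (Fin c → Fin d) → Fin d → MForm k d
graph (var x) σ z = σ x ≈ z
graph (op i t u) σ z = ∃ₘ ∃ₘ ∃ₘ
  graph t (λ x → 3 ↑ʳ σ x) 2F ∧ₘ graph u (λ x → 3 ↑ʳ σ x) 1F ∧ₘ
  rel i 2F 1F 0F ∧ₘ 0F ≈ suc (suc (suc z))

_≐_ : ∀ {k d} → Tm k d → Tm k d → MForm k d
t ≐ u = ∃ₘ graph t suc 0F ∧ₘ graph u suc 0F

-- `q` is the quotient by Leibniz equality, on which the relations become functions. `A` varies: `q`
-- takes values in the states of a model, and in ℕ for a standard structure.
record Functional {k : ℕ} (S : Structure k) : Set₁ where
  open Structure S
  field
    {A}      : Set
    q        : D → A
    F        : Fin k → D → D → D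
    F-rel    : ∀ i x y → Rel i x y (F i x y)
    rel-cong : ∀ {i x y z x′ y′ z′} → q x ≡ q x′ → q y ≡ q y′ →
               Rel i x y z → Rel i x′ y′ z′ → q z ≡ q z′
    leibniz  : ∀ {x y} → (∀ Y → Mem true Y x → Mem true Y y) ⇔ q x ≡ q y

  graph-correct : ∀ {c d} (t : Tm k c) (σ : Fin c → Fin d) z V →
    evalM S (graph t σ z) V ⇔ q (⟦ t ⟧ F (V ∘ σ)) ≡ q (V z)
  graph-correct (var x) σ z V = leibniz
  graph-correct (op i t u) σ z V = mk⇔
    (λ (x , y , w , tx , uy , xyw , w≈z) → trans
      (rel-cong (to (graph-correct t σ³ 2F (w ◂ y ◂ x ◂ V)) tx)
                (to (graph-correct u σ³ 1F (w ◂ y ◂ x ◂ V)) uy) (F-rel i _ _) xyw)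
      (to leibniz w≈z))
    (λ eq → let x = ⟦ t ⟧ F (V ∘ σ)
                y = ⟦ u ⟧ F (V ∘ σ)
                w = F i x y
      in x , y , w ,
         from (graph-correct t σ³ 2F (w ◂ y ◂ x ◂ V)) refl ,
         from (graph-correct u σ³ 1F (w ◂ y ◂ x ◂ V)) refl ,
         F-rel i x y , from leibniz eq)
    where σ³ = λ x → 3 ↑ʳ σ x

  ≐-correct : ∀ {d} (t u : Tm k d) V →
    evalM S (t ≐ u) V ⇔ q (⟦ t ⟧ F V) ≡ q (⟦ u ⟧ F V)
  ≐-correct t u V = mk⇔
    (λ (w , p , r) → trans (to (graph-correct t suc 0F (w ◂ V)) p)
                           (sym (to (graph-correct u suc 0F (w ◂ V)) r)))
    (λ eq → let w = ⟦ t ⟧ F V in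
      w , from (graph-correct t suc 0F (w ◂ V)) refl ,
          from (graph-correct u suc 0F (w ◂ V)) (sym eq))

-- A copy of ℕ modulo Leibniz equality. Both directions of the reduction produce one, so the
-- translation of arithmetic is verified only once.
record Standard {k : ℕ} (S : Structure k) (f : Fin k → ℕ → ℕ → ℕ) : Set₁ where
  open Structure S
  field
    val       : D → ℕ
    elem      : ℕ → D
    val-elem  : ∀ n → val (elem n) ≡ n
    F         : Fin k → D → D → D
    F-rel     : ∀ i x y → Rel i x y (F i x y)
    rel-sound : ∀ {i x y z} → Rel i x y z → val z ≡ f i (val x) (val y)
    leibniz   : ∀ {x y} → (∀ Y → Mem true Y x → Mem true Y y) ⇔ val x ≡ val y

  functional : Functional S
  functional = record
    { q = val
    ; F = F
    ; F-rel = F-rel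
    ; rel-cong = λ {i} x≡x′ y≡y′ r r′ →
        trans (rel-sound r) (trans (cong₂ (f i) x≡x′ y≡y′) (sym (rel-sound r′)))
    ; leibniz = leibniz
    }

  val-⟦⟧ : ∀ {d} (t : Tm k d) {V} → val (⟦ t ⟧ F V) ≡ ⟦ t ⟧ f (val ∘ V)
  val-⟦⟧ (var x) = refl
  val-⟦⟧ (op i t u) = trans (rel-sound (F-rel i _ _)) (cong₂ (f i) (val-⟦⟧ t) (val-⟦⟧ u))

  ≐-standard : ∀ {d} (t u : Tm k d) V →
    evalM S (t ≐ u) V ⇔ ⟦ t ⟧ f (val ∘ V) ≡ ⟦ u ⟧ f (val ∘ V)
  ≐-standard t u V = mk⇔
    (λ p → trans (sym (val-⟦⟧ t))
      (trans (to (Functional.≐-correct functional t u V) p) (val-⟦⟧ u)))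
    (λ eq → from (Functional.≐-correct functional t u V)
      (trans (val-⟦⟧ t) (trans eq (sym (val-⟦⟧ u)))))

-- Translation of arithmetic formulas

_⊕_ _⊛_ : ∀ {k d} → Tm (2 + k) d → Tm (2 + k) d → Tm (2 + k) d
t ⊕ u = op 0F t u
t ⊛ u = op 1F t u

lift : ∀ {d} → (ℕ → Fin d) → ℕ → Fin (suc d)
lift ρ zero = 0F
lift ρ (suc i) = suc (ρ i)

module _ {k : ℕ} where

  -- Zero and one are the variables `z` and `o`, so successor is addition of one; a unary function
  -- is a binary operation applied to a repeated argument.
  term : ∀ {d} → ATerm k → (z o : Fin d) → (ℕ → Fin d) → Tm (2 + k) d
  term (var i) z o ρ = var (ρ i)
  term zeroᵗ z o ρ = var z
  term (sucᵗ t) z o ρ = term t z o ρ ⊕ var o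
  term (t +ᵗ u) z o ρ = term t z o ρ ⊕ term u z o ρ
  term (t *ᵗ u) z o ρ = term t z o ρ ⊛ term u z o ρ
  term (app j t) z o ρ = op (suc (suc j)) (term t z o ρ) (term t z o ρ)

  form : ∀ {d} → AForm k → (z o : Fin d) → (ℕ → Fin d) → MForm (2 + k) d
  form (t =ᵃ u) z o ρ = term t z o ρ ≐ term u z o ρ
  form (t <ᵃ u) z o ρ =
    -- `t < u` means `suc t ≤ u`: some number added to `1 + t` gives `u`.
    ∃ₘ (var (suc o) ⊕ term t (suc z) (suc o) (suc ∘ ρ)) ⊕ var 0F ≐
       term u (suc z) (suc o) (suc ∘ ρ)
  form (¬ᵃ θ) z o ρ = ¬ₘ form θ z o ρ
  form (θ ∧ᵃ η) z o ρ = form θ z o ρ ∧ₘ form η z o ρ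
  form (θ ∨ᵃ η) z o ρ = form θ z o ρ ∨ₘ form η z o ρ
  form (∀ᵃ θ) z o ρ = ∀ₘ form θ (suc z) (suc o) (lift ρ)
  form (∃ᵃ θ) z o ρ = ∃ₘ form θ (suc z) (suc o) (lift ρ)

  numeral : ∀ {d} → ℕ → (z o : Fin d) → Tm (2 + k) d
  numeral zero z o = var z
  numeral (suc n) z o = numeral n z o ⊕ var o

  record Interprets (f : Fin (2 + k) → ℕ → ℕ → ℕ) (fs : Fin k → ℕ → ℕ) : Set where
    field
      plus  : ∀ m n → f 0F m n ≡ m + n
      times : ∀ m n → f 1F m n ≡ m * n
      diag  : ∀ j n → f (suc (suc j)) n n ≡ fs j n

  record Valuation {d} (W : Vector ℕ d) (z o : Fin d) (ρ : ℕ → Fin d) (e : Env) : Set where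
    field
      at-zero : W z ≡ 0
      at-one  : W o ≡ 1
      at-var  : ∀ i → W (ρ i) ≡ e i

  module _ {f fs} (I : Interprets f fs) where
    open Interprets I
    open Valuation

    term-correct : ∀ {d} (t : ATerm k) {W : Vector ℕ d} {z o ρ e} → Valuation W z o ρ e →
      ⟦ term t z o ρ ⟧ f W ≡ evalT t e fs
    term-correct (var i) v = at-var v i
    term-correct zeroᵗ v = at-zero v
    term-correct (sucᵗ t) {W} {o = o} v = trans (plus _ _)
      (trans (cong₂ _+_ (term-correct t v) (at-one v)) (+-comm _ 1))
    term-correct (t +ᵗ u) v =
      trans (plus _ _) (cong₂ _+_ (term-correct t v) (term-correct u v))
    term-correct (t *ᵗ u) v =
      trans (times _ _) (cong₂ _*_ (term-correct t v) (term-correct u v))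
    term-correct (app j t) v = trans (diag j _) (cong (fs j) (term-correct t v))

    numeral-correct : ∀ {d} n {W : Vector ℕ d} {z o} → W z ≡ 0 → W o ≡ 1 →
      ⟦ numeral n z o ⟧ f W ≡ n
    numeral-correct zero z0 o1 = z0
    numeral-correct (suc n) z0 o1 =
      trans (plus _ _) (trans (cong₂ _+_ (numeral-correct n z0 o1) o1) (+-comm _ 1))

    module _ {S : Structure (2 + k)} (M : Standard S f) where
      open Standard M

      extend : ∀ {d V z o ρ e x n} → Valuation {d} (val ∘ V) z o ρ e → val x ≡ n →
        Valuation (val ∘ (x ◂ V)) (suc z) (suc o) (lift ρ) (n ∷ₑ e)
      extend v eq = record { at-zero = at-zero v ; at-one = at-one v
        ; at-var = λ { zero → eq ; (suc i) → at-var v i } }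

      form-correct : ∀ {d} (θ : AForm k) {V} {z o : Fin d} {ρ e} → Valuation (val ∘ V) z o ρ e →
        evalM S (form θ z o ρ) V ⇔ evalF θ e fs
      form-correct (t =ᵃ u) {V} {z} {o} {ρ} v = mk⇔
        (λ p → trans (sym (term-correct t v)) (trans (to equation p) (term-correct u v)))
        (λ eq → from equation (trans (term-correct t v) (trans eq (sym (term-correct u v)))))
        where equation = ≐-standard (term t z o ρ) (term u z o ρ) V
      form-correct (t <ᵃ u) {V} {z} {o} {ρ} {e} v = mk⇔
        (λ (w , p) → subst (suc (evalT t e fs) ≤_)
          (trans (sym (lhs-correct w)) (trans (to (equation w) p) (term-correct u (v′ w))))
          (m≤m+n _ (val w)))
        (λ lt → let (n , eq) = m≤n⇒∃[o]m+o≡n lt in elem n , from (equation (elem n))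
          (trans (lhs-correct (elem n)) (trans (cong (suc (evalT t e fs) +_) (val-elem n))
            (trans eq (sym (term-correct u (v′ (elem n))))))))
        where
        lhs = (var (suc o) ⊕ term t (suc z) (suc o) (suc ∘ ρ)) ⊕ var 0F
        equation = λ w → ≐-standard lhs (term u (suc z) (suc o) (suc ∘ ρ)) (w ◂ V)
        v′ : ∀ w → Valuation (val ∘ (w ◂ V)) (suc z) (suc o) (suc ∘ ρ) e
        v′ w = record { at-zero = at-zero v ; at-one = at-one v ; at-var = at-var v }
        lhs-correct : ∀ w → ⟦ lhs ⟧ f (val ∘ (w ◂ V)) ≡ suc (evalT t e fs) + val w
        lhs-correct w = trans (plus _ _) (cong (_+ val w)
          (trans (plus _ _) (cong₂ _+_ (at-one v) (term-correct t (v′ w)))))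
      form-correct (¬ᵃ θ) v = mk⇔ (_∘ from (form-correct θ v)) (_∘ to (form-correct θ v))
      form-correct (θ ∧ᵃ η) v = mk⇔
        (λ (p , q) → to (form-correct θ v) p , to (form-correct η v) q)
        (λ (p , q) → from (form-correct θ v) p , from (form-correct η v) q)
      form-correct (θ ∨ᵃ η) v = mk⇔
        [ inj₁ ∘ to (form-correct θ v) , inj₂ ∘ to (form-correct η v) ]′
        [ inj₁ ∘ from (form-correct θ v) , inj₂ ∘ from (form-correct η v) ]′
      form-correct (∀ᵃ θ) v = mk⇔
        (λ p n → to (form-correct θ (extend v (val-elem n))) (p (elem n)))
        (λ p x → from (form-correct θ (extend v refl)) (p (val x)))
      form-correct (∃ᵃ θ) v = mk⇔
        (λ (x , p) → val x , to (form-correct θ (extend v refl)) p)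
        (λ (n , p) → elem n , from (form-correct θ (extend v (val-elem n))) p)

-- The axioms and the reduction formula

⋀ : ∀ {m k d} → (Fin m → MForm k d) → MForm k d → MForm k d
⋀ {zero} φ ψ = ψ
⋀ {suc m} φ ψ = φ 0F ∧ₘ ⋀ (φ ∘ suc) ψ

⋀-correct : ∀ {m k d} (S : Structure k) (φ : Fin m → MForm k d) {ψ V} →
  evalM S (⋀ φ ψ) V ⇔ ((∀ i → evalM S (φ i) V) × evalM S ψ V)
⋀-correct {zero} S φ = mk⇔ (λ p → (λ ()) , p) proj₂
⋀-correct {suc m} S φ = mk⇔
  (λ (p , q) → let (ps , r) = to (⋀-correct S (φ ∘ suc)) q
               in (λ { zero → p ; (suc i) → ps i }) , r)
  (λ (ps , r) → ps 0F , from (⋀-correct S (φ ∘ suc)) (ps ∘ suc , r))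

-- Together these make each relation the graph of a function modulo Leibniz equality; `congruent` at
-- equal arguments gives uniqueness of the value.
total congruent : ∀ {k d} → Fin k → MForm k d
total i = ∀ₘ ∀ₘ ∃ₘ rel i 2F 1F 0F
congruent i = ∀ₘ ∀ₘ ∀ₘ ∀ₘ ∀ₘ ∀ₘ
  5F ≈ 2F ⇒ₘ 4F ≈ 1F ⇒ₘ rel i 5F 4F 3F ⇒ₘ rel i 2F 1F 0F ⇒ₘ 3F ≈ 0F

-- Given excluded middle, these axioms yield comprehension: the answers at
-- different states can be chosen independently.
sets : ∀ {k d} → MForm k d
sets =
  (∀ₘ ∀ₘ mem true 0F 1F ⇒ₘ ¬ₘ mem false 0F 1F) ∧ₘ
  (∀ₘ ∃ₘ mem true 0F 1F) ∧ₘ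
  (∀ₘ ∃ₘ ¬ₘ mem true 0F 1F)

-- In the formulas with two free variables, 0 denotes one and 1 denotes zero.
recursion : ∀ {k} → MForm (2 + k) 2
recursion =
  (∀ₘ var 0F ⊕ var 2F ≐ var 0F) ∧ₘ
  (∀ₘ ∀ₘ var 1F ⊕ (var 0F ⊕ var 2F) ≐ var 1F ⊕ var 0F ⊕ var 2F) ∧ₘ
  (∀ₘ var 0F ⊛ var 2F ≐ var 2F) ∧ₘ
  (∀ₘ ∀ₘ var 1F ⊛ (var 0F ⊕ var 2F) ≐ var 1F ⊛ var 0F ⊕ var 1F)

-- Adding one serves as successor. Induction is a single axiom, as its first quantifier ranges over
-- strategies read as sets.
peano : ∀ {k} → MForm (2 + k) 2
peano =
  (∀ₘ mem true 0F 2F ⇒ₘ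
      (∀ₘ ∀ₘ mem true 2F 1F ⇒ₘ rel 0F 1F 3F 0F ⇒ₘ mem true 2F 0F) ⇒ₘ
      (∀ₘ mem true 1F 0F)) ∧ₘ
  (∀ₘ ∀ₘ var 1F ⊕ var 2F ≐ var 0F ⊕ var 2F ⇒ₘ 1F ≈ 0F) ∧ₘ
  (∀ₘ ¬ₘ (var 0F ⊕ var 1F ≐ var 2F)) ∧ₘ
  recursion

theory : ∀ {k} → MForm (2 + k) 2
theory = ⋀ total (⋀ congruent (sets ∧ₘ peano))

-- In `Σ¹₁Set` the number variables other than the input have value zero, so they are sent to the
-- index of zero.
inputVar : ℕ → Fin 3
inputVar zero = 0F
inputVar (suc _) = 2F

query : ∀ {k} → AForm k → ℕ → MForm (2 + k) 2
query θ n = ∃ₘ var 0F ≐ numeral n 2F 1F ∧ₘ form θ 2F 1F inputVar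

reduction : ∀ {k} → AForm k → ℕ → MForm (2 + k) 0
reduction θ n = ∃ₘ ∃ₘ theory ∧ₘ query θ n

-- The query and the axioms in a standard structure

module _ {k : ℕ} {S : Structure (2 + k)} {f : Fin (2 + k) → ℕ → ℕ → ℕ}
  {fs : Fin k → ℕ → ℕ} (M : Standard S f) (I : Interprets f fs) where
  open Structure S
  open Standard M
  open Interprets I
  open Functional functional using (rel-cong)

  query-correct : ∀ {o z} → val o ≡ 1 → val z ≡ 0 → ∀ θ n →
    evalM S (query θ n) (o ◂ z ◂ ε) ⇔ evalF θ (n ∷ₑ λ _ → zero) fs
  query-correct {o} {z} o≡1 z≡0 θ n = mk⇔
    (λ (x , x≐n , p) →
      to (form-correct I M θ (input (trans (to (equation x) x≐n) (numeral-correct I n z≡0 o≡1)))) p)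
    (λ p → elem n ,
      from (equation (elem n)) (trans (val-elem n) (sym (numeral-correct I n z≡0 o≡1))) ,
      from (form-correct I M θ (input (val-elem n))) p)
    where
    equation = λ x → ≐-standard (var 0F) (numeral n 2F 1F) (x ◂ o ◂ z ◂ ε)
    input : ∀ {x} → val x ≡ n →
      Valuation (val ∘ (x ◂ o ◂ z ◂ ε)) 2F 1F inputVar (n ∷ₑ λ _ → zero)
    input x≡n = record { at-zero = z≡0 ; at-one = o≡1
      ; at-var = λ { zero → x≡n ; (suc _) → z≡0 } }

  -- `sets` is assumed because `Standard` does not constrain `Mem false`; the other axioms are
  -- transferred from ℕ along `val`.
  theory-holds : ∀ {o z} → val o ≡ 1 → val z ≡ 0 → evalM S sets (o ◂ z ◂ ε) →
    evalM S theory (o ◂ z ◂ ε)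
  theory-holds {o} {z} o≡1 z≡0 sets-hold = from (⋀-correct S total)
    ( (λ i x y → F i x y , F-rel i x y)
    , from (⋀-correct S congruent)
      ( (λ i _ _ _ _ _ _ x≈x′ y≈y′ r r′ →
          from leibniz (rel-cong (to leibniz x≈x′) (to leibniz y≈y′) r r′))
      , sets-hold
      , (λ Y base step x → induction Y base step (val x) x refl)
      , (λ x y eq → from leibniz (suc-injective (trans (sym (plus-o x))
          (trans (to (≐-standard (var 1F ⊕ var 2F) (var 0F ⊕ var 2F) (y ◂ x ◂ o ◂ z ◂ ε)) eq)
            (plus-o y)))))
      , (λ x eq → 1+n≢0 (trans (sym (plus-o x))
          (trans (to (≐-standard (var 0F ⊕ var 1F) (var 2F) (x ◂ o ◂ z ◂ ε)) eq) z≡0)))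
      , (λ x → from (≐-standard (var 0F ⊕ var 2F) (var 0F) (x ◂ o ◂ z ◂ ε))
          (trans (plus _ _) (trans (cong (val x +_) z≡0) (+-identityʳ _))))
      , (λ x y → from (≐-standard (var 1F ⊕ (var 0F ⊕ var 2F)) (var 1F ⊕ var 0F ⊕ var 2F)
            (y ◂ x ◂ o ◂ z ◂ ε))
          (trans (cong (f 0F (val x)) (plus-o y)) (trans (plus _ _) (trans (+-suc _ _)
            (trans (cong suc (sym (plus _ _))) (sym (plus-one _)))))))
      , (λ x → from (≐-standard (var 0F ⊛ var 2F) (var 2F) (x ◂ o ◂ z ◂ ε))
          (trans (times _ _) (trans (cong (val x *_) z≡0) (trans (*-zeroʳ (val x)) (sym z≡0)))))
      , (λ x y → from (≐-standard (var 1F ⊛ (var 0F ⊕ var 2F)) (var 1F ⊛ var 0F ⊕ var 1F)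
            (y ◂ x ◂ o ◂ z ◂ ε))
          (trans (cong (f 1F (val x)) (plus-o y)) (trans (times _ _) (trans (*-suc (val x) (val y))
            (trans (+-comm (val x) _) (trans (cong (_+ val x) (sym (times _ _)))
              (sym (plus _ _))))))))))
    where
    plus-one : ∀ n → f 0F n (val o) ≡ suc n
    plus-one n = trans (plus _ _) (trans (cong (n +_) o≡1) (+-comm n 1))
    plus-o = plus-one ∘ val
    induction : ∀ Y → Mem true Y z →
      (∀ x y → Mem true Y x → Rel 0F x o y → Mem true Y y) → ∀ n x → val x ≡ n → Mem true Y x
    induction Y base step zero x x≡0 = from leibniz (trans z≡0 (sym x≡0)) Y base
    induction Y base step (suc n) x x≡1+n =
      -- `x` has the same value as the successor of `elem n`, so it lies in the same sets.
      from leibniz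
        (trans (rel-sound (F-rel 0F (elem n) o))
          (trans (plus-o (elem n)) (trans (cong suc (val-elem n)) (sym x≡1+n)))) Y
        (step (elem n) _ (induction Y base step n (elem n) (val-elem n)) (F-rel 0F (elem n) o))

-- A CGS built from given functions on ℕ

-- In closed form `2^m * (2n + 1) - 1`; the parity of the result tells the two clauses apart.
pair : ℕ → ℕ → ℕ
pair zero n = 2 * n
pair (suc m) n = suc (2 * pair m n)

pair-injective : ∀ m n m′ n′ → pair m n ≡ pair m′ n′ → m ≡ m′ × n ≡ n′
pair-injective zero n zero n′ eq = refl , *-cancelˡ-≡ n n′ 2 eq
pair-injective zero n (suc m′) n′ eq = contradiction eq (even≢odd n (pair m′ n′))
pair-injective (suc m) n zero n′ eq = contradiction (sym eq) (even≢odd n′ (pair m n))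
pair-injective (suc m) n (suc m′) n′ eq =
  let (p , q) = pair-injective m n m′ n′ (*-cancelˡ-≡ _ _ 2 (suc-injective eq)) in cong suc p , q

-- `mid` keeps the decision of the first step, so that labels can express relations between actions;
-- `end` keeps the answer that decides membership.
data State : Set where
  init : State
  mid  : (x y z : ℕ) → State
  end  : ℕ → State

tag payload code : State → ℕ
tag init = 0
tag (mid _ _ _) = 1
tag (end _) = 2
payload init = 0
payload (mid x y z) = pair x (pair y z)
payload (end n) = n
code s = pair (tag s) (payload s)

tag-payload-injective : ∀ s t → tag s ≡ tag t → payload s ≡ payload t → s ≡ t
tag-payload-injective init init _ _ = refl
tag-payload-injective (mid x y z) (mid x′ y′ z′) _ eq
  with refl , eq₁ ← pair-injective x (pair y z) x′ (pair y′ z′) eq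
  with refl , refl ← pair-injective y z y′ z′ eq₁ = refl
tag-payload-injective (end _) (end _) _ refl = refl

code-injective : ∀ {s t} → code s ≡ code t → s ≡ t
code-injective {s} {t} eq =
  let (p , q) = pair-injective (tag s) (payload s) (tag t) (payload t) eq
  in tag-payload-injective s t p q

does-sound : ∀ {P : Set} (P? : Dec P) → does P? ≡ true → P
does-sound (yes p) _ = p

module StandardCGS {k : ℕ} (fs : Fin k → ℕ → ℕ) where

  operation : Fin (2 + k) → ℕ → ℕ → ℕ
  operation 0F = _+_
  operation 1F = _*_
  operation (suc (suc j)) n _ = fs j n

  interprets : Interprets operation fs
  interprets = record
    { plus = λ _ _ → refl ; times = λ _ _ → refl ; diag = λ _ _ → refl }

  transition : State → (Fin 3 → ℕ) → State
  transition init δ = mid (δ 0F) (δ 1F) (δ 2F)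
  -- One agent is enough here, as in `mem` all agents give the same answer.
  transition (mid _ _ _) δ = end (δ 0F)
  transition (end n) δ = end n

  labelling : State → Fin (3 + k) → Bool
  labelling (mid x y z) (suc i) = does (operation i x y ≟ z)
  labelling (end n) zero = does (n ≟ 0)
  labelling _ _ = false

  standardCGS : CGS (3 + k) 3
  standardCGS = record
    { St = State
    ; Ac = ℕ
    ; St-countable = mk↣ code-injective
    ; Ac-countable = mk↣ {to = id} id
    ; s₀ = init
    ; someAction = 0
    ; label = labelling
    ; τ = transition
    }

  open StrategyStructure standardCGS
  open Structure strategies

  first : D → ℕ
  first f = f (init ∷ [])

  reply : D → ℕ → ℕ
  reply Y n = Y (init ∷ mid n n n ∷ [])

  mem-intro : ∀ b {Y x} → Literal b (does (reply Y (first x) ≟ 0)) → Mem b Y x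
  mem-intro b p = _ , (λ _ → refl) , _ , (λ _ → refl) , p

  mem-elim : ∀ b {Y x} → Mem b Y x → Literal b (does (reply Y (first x) ≟ 0))
  mem-elim b {Y} {x} (e , e≗ , e′ , e′≗ , p) = subst (λ n → Literal b (does (n ≟ 0))) eq p
    where
    eq : e′ 0F (after init e ∷ []) ≡ reply Y (first x)
    eq rewrite e′≗ 0F | e≗ 0F | e≗ 1F | e≗ 2F = refl

  -- Codes the singleton of `m`: the answer zero means membership, and among the states `mid n n n`
  -- the distance vanishes only for `n` equal to `m`.
  isolate : ℕ → D
  isolate m ρ = distance (last ρ)
    where
    distance : State → ℕ
    distance (mid n _ _) = ∣ n - m ∣
    distance _ = 0

  standard : Standard strategies operation
  standard = record
    { val = first
    ; elem = λ n _ → n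
    ; val-elem = λ _ → refl
    ; F = λ i x y _ → operation i (first x) (first y)
    ; F-rel = λ i x y → _ , (λ _ → refl) ,
        dec-true (operation i (first x) (first y) ≟ _) refl
    ; rel-sound = λ {i} → sound i
    ; leibniz = mk⇔ separate
        (λ x≡y Y m → mem-intro true {Y} (subst (λ n → does (reply Y n ≟ 0) ≡ true) x≡y
          (mem-elim true {Y} m)))
    }
    where
    sound : ∀ i {x y z} → Rel i x y z → first z ≡ operation i (first x) (first y)
    sound i (e , e≗ , p) rewrite sym (e≗ 0F) | sym (e≗ 1F) | sym (e≗ 2F) =
      sym (does-sound (operation i (first (e 0F)) (first (e 1F)) ≟ first (e 2F)) p)
    separate : ∀ {x y} → (∀ Y → Mem true Y x → Mem true Y y) → first x ≡ first y
    separate {x} {y} sub = sym (∣m-n∣≡0⇒m≡n (does-sound (∣ first y - first x ∣ ≟ 0)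
      (mem-elim true {isolate (first x)} (sub (isolate (first x))
        (mem-intro true {isolate (first x)} (dec-true (_ ≟ 0) (∣n-n∣≡0 (first x))))))))

  sets-hold : ∀ {d} {V : Vector D d} → evalM strategies sets V
  sets-hold =
    (λ x Y m m′ → mem-elim false {Y} m′ (mem-elim true {Y} m)) ,
    -- Constant answers zero and one give the full and the empty set.
    (λ x → (λ _ → 0) , mem-intro true {λ _ → 0} refl) ,
    (λ x → (λ _ → 1) , λ m → contradiction (mem-elim true {λ _ → 1} m) λ ())

-- The recursion equations determine addition and multiplication

module _ {k : ℕ} {S : Structure (2 + k)} {operation : Fin (2 + k) → ℕ → ℕ → ℕ}
  (M : Standard S operation) where
  open Structure S
  open Standard M

  module Arithmetic {o z : D} (z≡0 : val z ≡ 0)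
    (plus-o : ∀ n → operation 0F n (val o) ≡ suc n)
    (equations : evalM S recursion (o ◂ z ◂ ε)) where

    V₀ : Vector D 2
    V₀ = o ◂ z ◂ ε

    axiom : ∀ {d} (t u : Tm (2 + k) d) V → evalM S (t ≐ u) V →
      ⟦ t ⟧ operation (val ∘ V) ≡ ⟦ u ⟧ operation (val ∘ V)
    axiom t u V = to (≐-standard t u V)

    plus-zero : ∀ x → operation 0F (val x) 0 ≡ val x
    plus-zero x = trans (cong (operation 0F (val x)) (sym z≡0))
      (axiom (var 0F ⊕ var 2F) (var 0F) (x ◂ V₀) (proj₁ equations x))

    plus-suc : ∀ x y → operation 0F (val x) (suc (val y)) ≡ suc (operation 0F (val x) (val y))
    plus-suc x y = trans (cong (operation 0F (val x)) (sym (plus-o (val y))))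
      (trans (axiom (var 1F ⊕ (var 0F ⊕ var 2F)) (var 1F ⊕ var 0F ⊕ var 2F) (y ◂ x ◂ V₀)
        (proj₁ (proj₂ equations) x y)) (plus-o _))

    times-zero : ∀ x → operation 1F (val x) 0 ≡ 0
    times-zero x = trans (cong (operation 1F (val x)) (sym z≡0))
      (trans (axiom (var 0F ⊛ var 2F) (var 2F) (x ◂ V₀)
        (proj₁ (proj₂ (proj₂ equations)) x)) z≡0)

    times-suc : ∀ x y →
      operation 1F (val x) (suc (val y)) ≡ operation 0F (operation 1F (val x) (val y)) (val x)
    times-suc x y = trans (cong (operation 1F (val x)) (sym (plus-o (val y))))
      (axiom (var 1F ⊛ (var 0F ⊕ var 2F)) (var 1F ⊛ var 0F ⊕ var 1F) (y ◂ x ◂ V₀)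
        (proj₂ (proj₂ (proj₂ equations)) x y))

    is-plus : ∀ m n → operation 0F m n ≡ m + n
    is-plus m zero = trans
      (subst (λ a → operation 0F a 0 ≡ a) (val-elem m) (plus-zero (elem m)))
      (sym (+-identityʳ m))
    is-plus m (suc n) = trans
      (subst₂ (λ a b → operation 0F a (suc b) ≡ suc (operation 0F a b))
        (val-elem m) (val-elem n) (plus-suc (elem m) (elem n)))
      (trans (cong suc (is-plus m n)) (sym (+-suc m n)))

    is-times : ∀ m n → operation 1F m n ≡ m * n
    is-times m zero = trans
      (subst (λ a → operation 1F a 0 ≡ 0) (val-elem m) (times-zero (elem m)))
      (sym (*-zeroʳ m))
    is-times m (suc n) = trans
      (subst₂ (λ a b → operation 1F a (suc b) ≡ operation 0F (operation 1F a b) a)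
        (val-elem m) (val-elem n) (times-suc (elem m) (elem n)))
      (trans (is-plus _ m) (trans (cong (_+ m) (is-times m n))
        (trans (+-comm (m * n) m) (sym (*-suc m n)))))

    -- So far `o` is known only through `plus-o`; adding it to zero reveals its value.
    val-one : val o ≡ 1
    val-one = trans (sym (is-plus 0 (val o))) (plus-o 0)

-- A standard structure extracted from a model

module FromModel {k : ℕ} (G : CGS (3 + k) 3) (em : ExcludedMiddle 0ℓ) where
  open CGS G
  open StrategyStructure G
  open Structure strategies

  -- A choice operator, available because a positive answer of excluded middle carries a witness.
  choose : (Ac → Set) → Ac
  choose Q with em {P = Σ Ac Q}
  ... | yes (α , _) = α
  ... | no _ = someAction

  choose-sound : ∀ Q {α} → Q α → Q (choose Q)
  choose-sound Q {α} q with em {P = Σ Ac Q}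
  ... | yes (_ , q′) = q′
  ... | no ¬q = contradiction (α , q) ¬q

  Good : St → Ac → Set
  Good t α = label (τ t (λ _ → α)) zero ≡ true

  -- A strategy stands for this state rather than for its first action, since under the axioms
  -- strategies leading to the same state lie in the same sets.
  state : D → St
  state x = τ s₀ (λ _ → x (s₀ ∷ []))

  response : D → D → Ac
  response Y x = Y (s₀ ∷ state x ∷ [])

  thrice-const : ∀ {A : Set} {x : A} a → x ≡ thrice x a
  thrice-const 0F = refl
  thrice-const 1F = refl
  thrice-const 2F = refl

  -- Playing the same strategy λ _ → x for every agent makes the decision a
  -- constant function, hence determined by the action without extensionality.
  mem-intro : ∀ b {Y x} → Literal b (label (τ (state x) (λ _ → response Y x)) zero) → Mem b Y x
  mem-intro b p = _ , thrice-const , _ , thrice-const , p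

  respond : (St → Set) → D
  respond P ρ with em {P = P (last ρ)}
  ... | yes _ = choose (Good (last ρ))
  ... | no _ = choose (λ α → ¬ Good (last ρ) α)

  module _ {o z : D} (holds : evalM strategies theory (o ◂ z ◂ ε)) where

    V₀ : Vector D 2
    V₀ = o ◂ z ◂ ε

    -- abstract prevents the unfolding of these proofs, which is prohibitively slow.
    abstract
      totals : ∀ i x y → Σ D (Rel i x y)
      totals = proj₁ (to (⋀-correct strategies total) holds)

      rest : evalM strategies (⋀ congruent (sets ∧ₘ peano)) V₀
      rest = proj₂ (to (⋀-correct strategies total {V = V₀}) holds)

      congruences : ∀ i → evalM strategies (congruent i) V₀
      congruences = proj₁ (to (⋀-correct strategies congruent {V = V₀}) rest)

      sets-hold : evalM strategies sets V₀
      sets-hold = proj₁ (proj₂ (to (⋀-correct strategies congruent {V = V₀}) rest))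

      peano-holds : evalM strategies peano V₀
      peano-holds = proj₂ (proj₂ (to (⋀-correct strategies congruent {V = V₀}) rest))

      -- `Mem true` yields only some decisions pointwise equal to the constant ones. If the constant
      -- ones led to a state without the proposition, they would witness `Mem false`, which the
      -- first axiom of `sets` excludes; this takes the place of function extensionality.
      mem⇔ : ∀ Y x → Mem true Y x ⇔ Good (state x) (response Y x)
      mem⇔ Y x = mk⇔
        (λ m → decidable-stable (_ ≟ᵇ true)
          (λ bad → proj₁ sets-hold x Y m (mem-intro false {Y} {x} bad)))
        (mem-intro true {Y} {x})

      good-response : ∀ x → ∃ (Good (state x))
      good-response x = let (Y , m) = proj₁ (proj₂ sets-hold) x in response Y x , to (mem⇔ Y x) m

      bad-response : ∀ x → ∃ λ α → ¬ Good (state x) α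
      bad-response x =
        let (Y , ¬m) = proj₂ (proj₂ sets-hold) x in response Y x , ¬m ∘ from (mem⇔ Y x)

      respond-good : ∀ P x → Good (state x) (response (respond P) x) ⇔ P (state x)
      respond-good P x with em {P = P (state x)}
      ... | yes p = mk⇔ (λ _ → p) (λ _ → choose-sound (Good (state x)) (proj₂ (good-response x)))
      ... | no ¬p = mk⇔
        (λ good → contradiction good
          (choose-sound (λ α → ¬ Good (state x) α) (proj₂ (bad-response x))))
        (λ p → contradiction p ¬p)

      comprehension : ∀ P x → Mem true (respond P) x ⇔ P (state x)
      comprehension P x = mk⇔
        (to (respond-good P x) ∘ to (mem⇔ (respond P) x))
        (from (mem⇔ (respond P) x) ∘ from (respond-good P x))

      -- Comprehension provides the singleton of `state x` for one direction. For the other, `mem⇔`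
      -- shows that membership depends on `x` only through `state x`.
      leibniz : ∀ {x y} → (∀ Y → Mem true Y x → Mem true Y y) ⇔ state x ≡ state y
      leibniz {x} {y} = mk⇔
        (λ sub → to (comprehension (state x ≡_) y)
          (sub (respond (state x ≡_)) (from (comprehension (state x ≡_) x) refl)))
        (λ eq Y m → from (mem⇔ Y y)
          (subst (λ t → Good t (Y (s₀ ∷ t ∷ []))) eq (to (mem⇔ Y x) m)))

    functional : Functional strategies
    functional = record
      { q = state
      ; F = λ i x y → proj₁ (totals i x y)
      ; F-rel = λ i x y → proj₂ (totals i x y)
      ; rel-cong = λ {i} {x} {y} {z} {x′} {y′} {z′} x≡x′ y≡y′ r r′ →
          to leibniz (congruences i x y z x′ y′ z′ (from leibniz x≡x′) (from leibniz y≡y′) r r′)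
      ; leibniz = leibniz
      }

    open Functional functional using (F; F-rel; rel-cong; ≐-correct)

    elem : ℕ → D
    elem zero = z
    elem (suc n) = F 0F (elem n) o

    suc-cancel : ∀ {x y} → state (F 0F x o) ≡ state (F 0F y o) → state x ≡ state y
    suc-cancel {x} {y} eq = to leibniz (proj₁ (proj₂ peano-holds) x y
      (from (≐-correct (var 1F ⊕ var 2F) (var 0F ⊕ var 2F) (y ◂ x ◂ V₀)) eq))

    suc≢zero : ∀ {x} → state (F 0F x o) ≢ state z
    suc≢zero {x} eq = proj₁ (proj₂ (proj₂ peano-holds)) x
      (from (≐-correct (var 0F ⊕ var 1F) (var 2F) (x ◂ V₀)) eq)

    elem-injective : ∀ m n → state (elem m) ≡ state (elem n) → m ≡ n
    elem-injective zero zero _ = refl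
    elem-injective zero (suc n) eq = contradiction (sym eq) suc≢zero
    elem-injective (suc m) zero eq = contradiction eq suc≢zero
    elem-injective (suc m) (suc n) eq = cong suc (elem-injective m n (suc-cancel eq))

    IsNumber : St → Set
    IsNumber t = ∃ λ n → t ≡ state (elem n)

    abstract
      -- Induction applied to the set of standard numbers, which exists by comprehension, excludes
      -- nonstandard elements.
      number : ∀ x → IsNumber (state x)
      number x = to (comprehension IsNumber x) (proj₁ peano-holds (respond IsNumber)
        (from (comprehension IsNumber z) (0 , refl))
        (λ y w m r → let (n , eq) = to (comprehension IsNumber y) m in
          from (comprehension IsNumber w) (suc n , rel-cong eq refl r (F-rel 0F (elem n) o)))
        x)

    val : D → ℕ
    val x = proj₁ (number x)

    val-correct : ∀ x → state x ≡ state (elem (val x))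
    val-correct x = proj₂ (number x)

    val-cong : ∀ {x y} → state x ≡ state y ⇔ val x ≡ val y
    val-cong {x} {y} = mk⇔
      (λ eq → elem-injective _ _ (trans (sym (val-correct x)) (trans eq (val-correct y))))
      (λ eq → trans (val-correct x) (trans (cong (state ∘ elem) eq) (sym (val-correct y))))

    val-elem : ∀ n → val (elem n) ≡ n
    val-elem n = elem-injective _ _ (sym (val-correct (elem n)))

    operation : Fin (2 + k) → ℕ → ℕ → ℕ
    operation i m n = val (F i (elem m) (elem n))

    rel-sound : ∀ {i x y w} → Rel i x y w → val w ≡ operation i (val x) (val y)
    rel-sound {i} {x} {y} r = to val-cong (rel-cong (val-correct x) (val-correct y) r (F-rel i _ _))

    standard : Standard strategies operation
    standard = record
      { val = val
      ; elem = elem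
      ; val-elem = val-elem
      ; F = F
      ; F-rel = F-rel
      ; rel-sound = rel-sound
      ; leibniz = mk⇔ (to val-cong ∘ to leibniz) (from leibniz ∘ from val-cong)
      }

    val-zero : val z ≡ 0
    val-zero = val-elem 0

    plus-o : ∀ n → operation 0F n (val o) ≡ suc n
    plus-o n = trans (sym (trans (rel-sound (F-rel 0F (elem n) o))
      (cong (λ m → operation 0F m (val o)) (val-elem n)))) (val-elem (suc n))

    recursion-holds : evalM strategies recursion V₀
    recursion-holds = proj₂ (proj₂ (proj₂ peano-holds))

-- The reduction and its correctness

sentenceOf : ∀ {k} → AForm k → ℕ → SLSentence
sentenceOf {k} θ n = record
  { nAP = 2 + k
  ; nAg = 2
  ; formula = toSL (reduction θ n)
  ; sentence = λ l l∈ → case free-toSL (reduction θ n) l∈ of λ ()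
  }

module _ {k : ℕ} (θ : AForm k) (n : ℕ) (em : ExcludedMiddle 0ℓ) where

  ⊨-reduction : (G : CGS (3 + k) 3) →
    (G ⊨ toSL (reduction θ n)) ⇔ evalM (StrategyStructure.strategies G) (reduction θ n) ε
  ⊨-reduction G = StrategyStructure.sat-toSL G em (reduction θ n) {V = ε} λ ()

  satisfiable⇒Σ¹₁ : Satisfiable (sentenceOf θ n) → Σ¹₁Set θ n
  satisfiable⇒Σ¹₁ (G , G⊨) =
    let (z , o , holds , answer) = to (⊨-reduction G) G⊨
        open FromModel G em
        open Arithmetic (standard holds) (val-zero holds) (plus-o holds) (recursion-holds holds)
        -- The translation repeats the argument of a function symbol, so the diagonal is the
        -- function it denotes.
        functions = λ j m → operation holds (suc (suc j)) m m
    in functions ,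
       to (query-correct {fs = functions} (standard holds)
            (record { plus = is-plus ; times = is-times ; diag = λ _ _ → refl })
            val-one (val-zero holds) θ n) answer

  Σ¹₁⇒satisfiable : Σ¹₁Set θ n → Satisfiable (sentenceOf θ n)
  Σ¹₁⇒satisfiable (fs , answer) = standardCGS , from (⊨-reduction standardCGS)
    ( zeroˢ , oneˢ
    , theory-holds standard interprets refl refl (sets-hold {V = oneˢ ◂ zeroˢ ◂ ε})
    , from (query-correct standard interprets refl refl θ n) answer)
    where
    open StandardCGS fs
    zeroˢ oneˢ : List⁺ State → ℕ
    zeroˢ _ = 0
    oneˢ _ = 1

theorem3p10 : Σ¹₁-hard Satisfiable
theorem3p10 k θ = sentenceOf θ , λ (em , _) n →
  mk⇔ (Σ¹₁⇒satisfiable θ n em) (satisfiable⇒Σ¹₁ θ n em)
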